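{- For any extended patterns $p,p'$, if $p\Longrightarrow_{\mathfrak{R}_{\setminus}}p'$ (one rewrite step) then $[\![p]\!]=[\![p']\!]$.
   Context: Signature. $\mathcal{C}$ is a finite set of constructors with arities, $\mathcal{X}$ a countable set of variables, $\mathcal{T}(\mathcal{C},\mathcal{X})$ the set of terms over them, $\mathcal{T}(\mathcal{C})$ the ground terms. Tuples $\langle p_1,\dots,p_n\rangle$ are built with tuple symbols (one per arity). Extended patterns: $p::=x\in\mathcal{X}\mid c(p_1,\dots,p_n)\mid p_1+p_2\mid p_1\setminus p_2\mid\bot$ with $c\in\mathcal{C}$ ($+,\setminus,\bot$ are formal symbols; $\setminus$ binds tighter than $+$). All notions extend to tuples: $n$-tuples of extended patterns, and their combinations (at fixed arity) by $+,\setminus,\bot$, are also called extended patterns. All extended patterns are assumed linear: $p_1+p_2$ is linear if $p_1,p_2$ are; $c(p_1,\dots,p_n)$ (or a tuple) is linear if the $p_i$ are linear with disjoint variables; $p_1\setminus p_2$ is linear if $p_1,p_2$ are linear with disjoint variables. Additive: contains no $\setminus$. Pure: contains no $\bot$. Ground semantics: $[\![x]\!]=\mathcal{T}(\mathcal{C})$, $[\![c(p_1,\dots,p_n)]\!]=\{c(t_1,\dots,t_n)\mid t_i\in[\![p_i]\!]\}$ (likewise for tuples), $[\![p_1+p_2]\!]=[\![p_1]\!]\cup[\![p_2]\!]$, $[\![p_1\setminus p_2]\!]=[\![p_1]\!]\setminus[\![p_2]\!]$ (set difference), $[\![\bot]\!]=\emptyset$. Rewriting system $\mathfrak{R}_{\setminus}$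 (applied at any position of an extended pattern): here $v,v_i,w,w_i$ range over additive patterns, $t_i$ over pure additive patterns, $V$ over pattern variables; $z_i$ are freshly generated pattern variables; $f,g$ range over all constructors and tuple symbols, $h$ over constructors of positive arity and tuple symbols. (A1) $\bot+v\Rightarrow v$; (A2) $v+\bot\Rightarrow v$; (E1) $h(v_1,\dots,\bot,\dots,v_n)\Rightarrow\bot$; (S1) $h(v_1,\dots,v_i+w_i,\dots,v_n)\Rightarrow h(v_1,\dots,v_i,\dots,v_n)+h(v_1,\dots,w_i,\dots,v_n)$; (M1) $v\setminus V\Rightarrow\bot$; (M2) $v\setminus\bot\Rightarrow v$; (M3) $w\setminus(v_1+v_2)\Rightarrow(w\setminus v_1)\setminus v_2$; (M4) $V\setminus g(t_1,\dots,t_n)\Rightarrow\big(\sum_{c\in\mathcal{C}}c(z_1,\dots,z_m)\big)\setminus g(t_1,\dots,t_n)$ with $m$ the arity of $c$; (M5) $\bot\setminus f(v_1,\dots,v_n)\Rightarrow\bot$; (M6) $(v+w)\setminus f(v_1,\dots,v_n)\Rightarrow(v\setminus f(v_1,\dots,v_n))+(w\setminus f(v_1,\dots,v_n))$; (M7) $f(v_1,\dots,v_n)\setminus f(t_1,\dots,t_n)\Rightarrow f(v_1\setminus t_1,\dots,v_n)+\cdots+f(v_1,\dots,v_n\setminus t_n)$ (for a constant $c$: $c\setminus c\Rightarrow\bot$); (M8) $f(v_1,\dots,v_n)\setminus g(w_1,\dots,w_m)\Rightarrow f(v_1,\dots,v_n)$ if $f\neq g$. -}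

module Defs where

open import Data.Fin.Base using (Fin)
open import Data.List.Base using (List; []; _++_) renaming ([_] to [_]ᴸ)
open import Data.List.Membership.Propositional using (_∉_)
open import Data.List.Relation.Binary.Disjoint.Propositional using (Disjoint)
open import Data.Nat.Base using (ℕ; zero; suc)
open import Data.Product.Base using (∃-syntax; _×_)
open import Data.Unit.Base using (⊤)
open import Data.Vec.Base using (Vec; []; _∷_; lookup; map; tabulate; _[_]≔_)
open import Data.Vec.Relation.Unary.All using (All)
open import Data.Vec.Relation.Unary.AllPairs using (AllPairs)
open import Data.Vec.Relation.Unary.Unique.Propositional using (Unique)
open import Function.Base using (_on_)
open import Function.Bundles using (_↔_; _↣_; Inverse)
open import Level using (0ℓ)
open import Relation.Binary.PropositionalEquality.Core using (_≡_; _≢_)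
open import Relation.Unary as U using (Pred; _∪_; ∅)

record Signature : Set₁ where
  field
    C         : Set
    size      : ℕ
    finite    : C ↔ Fin size
    arity     : C → ℕ
    X         : Set
    countable : X ↣ ℕ

-- Patterns come in two kinds: ordinary ones, and n-tuples (with their
-- combinations at fixed n). Tuples contain ordinary patterns only.
data Sort : Set where
  term  : Sort
  tuple : ℕ → Sort

module Patterns (𝓢 : Signature) where
  open Signature 𝓢

  private
    variable
      s : Sort
      n : ℕ

  data Symbol : Sort → Set where
    con : C → Symbol term
    tup : ∀ n → Symbol (tuple n)

  ∥_∥ : Symbol s → ℕ
  ∥ con c ∥ = arity c
  ∥ tup n ∥ = n

  -- Ground term term is 𝒯(𝒞), and Ground (tuple n) its n-tuples.
  data Ground : Sort → Set where
    app : (f : Symbol s) → Vec (Ground term) ∥ f ∥ → Ground s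

  infixl 6 _+_
  infixl 7 _∖_

  data Pattern : Sort → Set where
    var : X → Pattern term
    app : (f : Symbol s) → Vec (Pattern term) ∥ f ∥ → Pattern s
    _+_ : Pattern s → Pattern s → Pattern s
    _∖_ : Pattern s → Pattern s → Pattern s
    ⊥   : Pattern s

  vars  : Pattern s → List X
  vars* : Vec (Pattern term) n → List X

  vars (var x)    = [ x ]ᴸ
  vars (app f ps) = vars* ps
  vars (p + q)    = vars p ++ vars q
  vars (p ∖ q)    = vars p ++ vars q
  vars ⊥          = []

  vars* []       = []
  vars* (p ∷ ps) = vars p ++ vars* ps

  data Linear : Pattern s → Set where
    var : ∀ x → Linear (var x)
    app : ∀ (f : Symbol s) {ps} → All Linear ps →
          AllPairs (Disjoint on vars) ps → Linear (app f ps)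
    _+_ : ∀ {p q : Pattern s} → Linear p → Linear q → Linear (p + q)
    dif : ∀ {p q : Pattern s} → Linear p → Linear q →
          Disjoint (vars p) (vars q) → Linear (p ∖ q)
    ⊥   : Linear {s} ⊥

  data Additive : Pattern s → Set where
    var : ∀ x → Additive (var x)
    app : ∀ (f : Symbol s) {ps} → All Additive ps → Additive (app f ps)
    _+_ : ∀ {p q : Pattern s} → Additive p → Additive q → Additive (p + q)
    ⊥   : Additive {s} ⊥

  data Pure : Pattern s → Set where
    var : ∀ x → Pure (var x)
    app : ∀ (f : Symbol s) {ps} → All Pure ps → Pure (app f ps)
    _+_ : ∀ {p q : Pattern s} → Pure p → Pure q → Pure (p + q)
    _∖_ : ∀ {p q : Pattern s} → Pure p → Pure q → Pure (p ∖ q)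

  ⟦_⟧  : Pattern s → Pred (Ground s) 0ℓ
  ⟦_⟧* : Vec (Pattern term) n → Pred (Vec (Ground term) n) 0ℓ

  ⟦ var x ⟧    = U.U
  ⟦ app f ps ⟧ = λ t → ∃[ ts ] (t ≡ app f ts × ⟦ ps ⟧* ts)
  ⟦ p + q ⟧    = ⟦ p ⟧ ∪ ⟦ q ⟧
  ⟦ p ∖ q ⟧    = ⟦ p ⟧ U.∖ ⟦ q ⟧
  ⟦ ⊥ ⟧        = ∅

  ⟦ [] ⟧*     []       = ⊤
  ⟦ p ∷ ps ⟧* (t ∷ ts) = ⟦ p ⟧ t × ⟦ ps ⟧* ts

  -- Iterated formal sum. The empty sum is ⊥; a one-element sum is its element.
  ∑ : Vec (Pattern s) n → Pattern s
  ∑ []           = ⊥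
  ∑ (p ∷ [])     = p
  ∑ (p ∷ q ∷ ps) = p + ∑ (q ∷ ps)

  ∑ᶜ : (C → Pattern s) → Pattern s
  ∑ᶜ p = ∑ (tabulate λ i → p (Inverse.from finite i))

  -- Freshly generated variables for each constructor: distinct within each
  -- c(z₁,…,zₘ) and outside xs. Different summands may reuse the same
  -- variables (as linearity of sums allows) but need not.
  Fresh : List X → ((c : C) → Vec X (arity c)) → Set
  Fresh xs z = ∀ c → Unique (z c) × All (_∉ xs) (z c)

  -- Head steps, where fresh variables are to be chosen outside xs.
  -- Additivity of all arguments vs already covers the i-th one in E1 and S1;
  -- the mere existence of a position i forces positive arity there.
  data Rule (xs : List X) : Pattern s → Pattern s → Set where
    A1 : ∀ {v : Pattern s} → Additive v → Rule xs (⊥ + v) v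
    A2 : ∀ {v : Pattern s} → Additive v → Rule xs (v + ⊥) v

    E1 : ∀ {h : Symbol s} {vs} i → All Additive vs → lookup vs i ≡ ⊥ →
         Rule xs (app h vs) ⊥
    S1 : ∀ {h : Symbol s} {vs} i {v w} → All Additive vs →
         lookup vs i ≡ v + w →
         Rule xs (app h vs) (app h (vs [ i ]≔ v) + app h (vs [ i ]≔ w))

    M1 : ∀ {v} {V : X} → Additive v → Rule xs (v ∖ var V) ⊥
    M2 : ∀ {v : Pattern s} → Additive v → Rule xs (v ∖ ⊥) v
    M3 : ∀ {w v₁ v₂ : Pattern s} → Additive w → Additive v₁ → Additive v₂ →
         Rule xs (w ∖ (v₁ + v₂)) ((w ∖ v₁) ∖ v₂)
    M4 : ∀ {V : X} {g : Symbol term} {ts} z → All Additive ts → All Pure ts →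
         Fresh xs z →
         Rule xs (var V ∖ app g ts)
                 (∑ᶜ (λ c → app (con c) (map var (z c))) ∖ app g ts)
    M5 : ∀ {f : Symbol s} {vs} → All Additive vs → Rule xs (⊥ ∖ app f vs) ⊥
    M6 : ∀ {v w : Pattern s} {f vs} → Additive v → Additive w →
         All Additive vs →
         Rule xs ((v + w) ∖ app f vs) ((v ∖ app f vs) + (w ∖ app f vs))
    M7 : ∀ {f : Symbol s} {vs ts} → All Additive vs →
         All Additive ts → All Pure ts →
         Rule xs (app f vs ∖ app f ts)
                 (∑ (tabulate λ i →
                      app f (vs [ i ]≔ (lookup vs i ∖ lookup ts i))))
    M8 : ∀ {f g : Symbol s} {vs ws} → All Additive vs → All Additive ws →
         f ≢ g → Rule xs (app f vs ∖ app g ws) (app f vs)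

  data Step (xs : List X) : Pattern s → Pattern s → Set where
    here : ∀ {p p′ : Pattern s} → Rule xs p p′ → Step xs p p′
    arg  : ∀ {f : Symbol s} {ps} i {p′} → Step xs (lookup ps i) p′ →
           Step xs (app f ps) (app f (ps [ i ]≔ p′))
    +ˡ   : ∀ {p p′ q : Pattern s} → Step xs p p′ → Step xs (p + q) (p′ + q)
    +ʳ   : ∀ {p q q′ : Pattern s} → Step xs q q′ → Step xs (p + q) (p + q′)
    ∖ˡ   : ∀ {p p′ q : Pattern s} → Step xs p p′ → Step xs (p ∖ q) (p′ ∖ q)
    ∖ʳ   : ∀ {p q q′ : Pattern s} → Step xs q q′ → Step xs (p ∖ q) (p ∖ q′)

  infix 4 _⟹_

  -- Fresh variables avoid the whole pattern being rewritten, not just the redex.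
  _⟹_ : Pattern s → Pattern s → Set
  p ⟹ p′ = Step (vars p) p p′

{-# OPTIONS --safe #-}

-- Only (M7) is delicate: a tuple that fails to match ⟨t₁,…,tₙ⟩ must fail at some
-- definite position i. Constructively this holds because matching a ground term
-- against a pattern is decidable, the finite set of constructors having decidable
-- equality.

module Submission where

open import Data.Fin.Base using (Fin; zero; suc)
open import Data.Fin.Properties using (inj⇒≟)
open import Data.Nat.Base using (ℕ; zero; suc)
open import Data.Product.Base using (∃-syntax; _×_; _,_; map₁; map₂)
open import Data.Sum.Base as Sum using (inj₁; inj₂)
open import Data.Unit.Base using (tt)
open import Data.Vec.Base using (Vec; []; _∷_; lookup; map; tabulate; _[_]≔_)
open import Function.Base using (_∘_)
open import Function.Bundles using (Inverse)
open import Function.Properties.Inverse using (↔⇒↣)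
open import Relation.Binary.Definitions using (DecidableEquality)
open import Relation.Binary.PropositionalEquality using (_≡_; refl; sym; cong; subst)
open import Relation.Nullary using (yes; no; contradiction)
open import Relation.Nullary.Decidable using (map′; ¬?; _×-dec_; _⊎-dec_)
open import Relation.Unary using (_≐_; _∈_; _∉_; _⊆_; Decidable; ⋃)
open import Defs

module Semantics (𝓢 : Signature) where
  open Signature 𝓢
  open Patterns 𝓢

  private
    variable
      s : Sort
      n : ℕ
      ts : Vec (Ground term) n

  -- A constructive De Morgan law for finite conjunctions: positions are tested from the left, and a
  -- matching head pushes the failure into the tail.
  ¬⟦⟧*⇒∃¬ : (ps : Vec (Pattern term) n) → (∀ i → Decidable ⟦ lookup ps i ⟧) →
            ts ∉ ⟦ ps ⟧* → ∃[ i ] lookup ts i ∉ ⟦ lookup ps i ⟧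
  ¬⟦⟧*⇒∃¬ {ts = []}     []       dec ∉ps = contradiction tt ∉ps
  ¬⟦⟧*⇒∃¬ {ts = t ∷ ts} (p ∷ ps) dec ∉ps with dec zero t
  ... | no  ∉p = zero , ∉p
  ... | yes ∈p with ¬⟦⟧*⇒∃¬ ps (dec ∘ suc) (∉ps ∘ (∈p ,_))
  ...   | i , ∉pᵢ = suc i , ∉pᵢ

  _≟ˢ_ : DecidableEquality (Symbol s)
  con c ≟ˢ con d = map′ (cong con) (λ { refl → refl }) (inj⇒≟ (↔⇒↣ finite) c d)
  tup n ≟ˢ tup n = yes refl

  app-injectiveˡ : ∀ {f g : Symbol s} {ts us} →
                   Ground.app f ts ≡ app g us → f ≡ g
  app-injectiveˡ refl = refl

  ⟦_⟧?  : (p : Pattern s) → Decidable ⟦ p ⟧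
  ⟦_⟧*? : (ps : Vec (Pattern term) n) → Decidable ⟦ ps ⟧*

  ⟦ var x ⟧?    t = yes tt
  ⟦ app f ps ⟧? (app g ts) with f ≟ˢ g
  ... | yes refl = map′ (λ ∈ps → ts , refl , ∈ps) (λ { (_ , refl , ∈ps) → ∈ps }) (⟦ ps ⟧*? ts)
  ... | no  f≢g  = no λ { (_ , eq , _) → f≢g (sym (app-injectiveˡ eq)) }
  ⟦ p + q ⟧?    t = ⟦ p ⟧? t ⊎-dec ⟦ q ⟧? t
  ⟦ p ∖ q ⟧?    t = ⟦ p ⟧? t ×-dec ¬? (⟦ q ⟧? t)
  ⟦ ⊥ ⟧?        t = no λ ()

  ⟦ [] ⟧*?     []       = yes tt
  ⟦ p ∷ ps ⟧*? (t ∷ ts) = ⟦ p ⟧? t ×-dec ⟦ ps ⟧*? ts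

  ⟦⟧*-lookup : (ps : Vec (Pattern term) n) → ts ∈ ⟦ ps ⟧* →
               ∀ i → lookup ts i ∈ ⟦ lookup ps i ⟧
  ⟦⟧*-lookup {ts = _ ∷ _} (p ∷ ps) (∈p , ∈ps) zero    = ∈p
  ⟦⟧*-lookup {ts = _ ∷ _} (p ∷ ps) (∈p , ∈ps) (suc i) = ⟦⟧*-lookup ps ∈ps i

  ⟦⟧*-update⁺ : ∀ (ps : Vec (Pattern term) n) i {q} → ts ∈ ⟦ ps ⟧* →
                lookup ts i ∈ ⟦ q ⟧ → ts ∈ ⟦ ps [ i ]≔ q ⟧*
  ⟦⟧*-update⁺ {ts = _ ∷ _} (p ∷ ps) zero    (_  , ∈ps) ∈q = ∈q , ∈ps
  ⟦⟧*-update⁺ {ts = _ ∷ _} (p ∷ ps) (suc i) (∈p , ∈ps) ∈q = ∈p , ⟦⟧*-update⁺ ps i ∈ps ∈q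

  -- Overwriting position `i` forgets whether the old pattern matched there; the second component
  -- recovers `ts ∈ ⟦ ps ⟧*` once that single fact is supplied.
  ⟦⟧*-update⁻ : ∀ (ps : Vec (Pattern term) n) i {q} → ts ∈ ⟦ ps [ i ]≔ q ⟧* →
                lookup ts i ∈ ⟦ q ⟧ × (lookup ts i ∈ ⟦ lookup ps i ⟧ → ts ∈ ⟦ ps ⟧*)
  ⟦⟧*-update⁻ {ts = _ ∷ _} (p ∷ ps) zero    (∈q , ∈ps) = ∈q , (_, ∈ps)
  ⟦⟧*-update⁻ {ts = _ ∷ _} (p ∷ ps) (suc i) (∈p , ∈ps) =
    map₂ (λ restore → (∈p ,_) ∘ restore) (⟦⟧*-update⁻ ps i ∈ps)

  ⟦map-var⟧*-universal : (xs : Vec X n) (ts : Vec (Ground term) n) → ts ∈ ⟦ map var xs ⟧*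
  ⟦map-var⟧*-universal []       []       = tt
  ⟦map-var⟧*-universal (x ∷ xs) (t ∷ ts) = tt , ⟦map-var⟧*-universal xs ts

  -- Serves the reverse inclusions both of `S1` and of a rewrite step below a symbol.
  app-update-⊆ : ∀ (f : Symbol s) ps i {q} → ⟦ q ⟧ ⊆ ⟦ lookup ps i ⟧ →
                 ⟦ app f (ps [ i ]≔ q) ⟧ ⊆ ⟦ app f ps ⟧
  app-update-⊆ f ps i q⊆pᵢ (ts , refl , ∈upd) with ⟦⟧*-update⁻ ps i ∈upd
  ... | ∈q , restore = ts , refl , restore (q⊆pᵢ ∈q)

  ⟦∑⟧ : (p : Fin n → Pattern s) → ⟦ ∑ (tabulate p) ⟧ ≐ ⋃ (Fin n) (⟦_⟧ ∘ p)
  ⟦∑⟧ {n = zero}        p = (λ ()) , λ ()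
  -- A one-element sum is its element, with no trailing `⊥`, so this case carries no injection and
  -- the recursion starts at two summands.
  ⟦∑⟧ {n = suc zero}    p = (zero ,_) , λ { (zero , ∈p) → ∈p }
  ⟦∑⟧ {n = suc (suc n)} p with ⟦∑⟧ (p ∘ suc)
  ... | ∑⊆⋃ , ⋃⊆∑ = to , from
    where
    to : ⟦ ∑ (tabulate p) ⟧ ⊆ ⋃ (Fin (suc (suc n))) (⟦_⟧ ∘ p)
    to (inj₁ ∈p) = zero , ∈p
    to (inj₂ ∈∑) with ∑⊆⋃ ∈∑
    ... | i , ∈p = suc i , ∈p

    from : ⋃ (Fin (suc (suc n))) (⟦_⟧ ∘ p) ⊆ ⟦ ∑ (tabulate p) ⟧
    from (zero  , ∈p) = inj₁ ∈p
    from (suc i , ∈p) = inj₂ (⋃⊆∑ (i , ∈p))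

  ∑ᶜ⁺ : ∀ (p : C → Pattern s) c → ⟦ p c ⟧ ⊆ ⟦ ∑ᶜ p ⟧
  ∑ᶜ⁺ p c {t} ∈p with ⟦∑⟧ (p ∘ Inverse.from finite)
  -- Summands are indexed by `Fin size`: that of `c` sits at `to c`, and membership is transported
  -- along `from (to c) ≡ c`.
  ... | _ , ⋃⊆∑ = ⋃⊆∑ (Inverse.to finite c ,
                       subst (λ d → t ∈ ⟦ p d ⟧) (sym (Inverse.strictlyInverseʳ finite c)) ∈p)

  -- Every ground term has some constructor at its root, and the summand of that constructor
  -- constrains no argument. Hence the expansion in `M4` denotes the same set as a variable.
  ∑ᶜ-con-universal : (z : (c : C) → Vec X (arity c)) →
                     ∀ t → t ∈ ⟦ ∑ᶜ (λ c → app (con c) (map var (z c))) ⟧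
  ∑ᶜ-con-universal z (app (con c) ts) =
    ∑ᶜ⁺ (λ c → app (con c) (map var (z c))) c (ts , refl , ⟦map-var⟧*-universal (z c) ts)

  -- If the arguments match `ps` but not `qs`, a failing position `i` of `qs` selects the `i`-th
  -- summand. Conversely, failure at one position already excludes `qs`. For arity zero both sides
  -- are empty, the empty sum being `⊥`.
  app∖app : (f : Symbol s) (ps qs : Vec (Pattern term) ∥ f ∥) →
            ⟦ app f ps ∖ app f qs ⟧ ≐
            ⟦ ∑ (tabulate λ i → app f (ps [ i ]≔ (lookup ps i ∖ lookup qs i))) ⟧
  app∖app f ps qs with ⟦∑⟧ (λ i → app f (ps [ i ]≔ (lookup ps i ∖ lookup qs i)))
  ... | ∑⊆⋃ , ⋃⊆∑ = to , from ∘ ∑⊆⋃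
    where
    to : ⟦ app f ps ∖ app f qs ⟧ ⊆
         ⟦ ∑ (tabulate λ i → app f (ps [ i ]≔ (lookup ps i ∖ lookup qs i))) ⟧
    to ((ts , refl , ∈ps) , ∉fqs)
      with ¬⟦⟧*⇒∃¬ qs (λ i → ⟦ lookup qs i ⟧?) (λ ∈qs → ∉fqs (ts , refl , ∈qs))
    ... | i , ∉qᵢ = ⋃⊆∑ (i , ts , refl , ⟦⟧*-update⁺ ps i ∈ps (⟦⟧*-lookup ps ∈ps i , ∉qᵢ))

    from : ⋃ (Fin ∥ f ∥) (λ i → ⟦ app f (ps [ i ]≔ (lookup ps i ∖ lookup qs i)) ⟧) ⊆
           ⟦ app f ps ∖ app f qs ⟧
    from (i , ts , refl , ∈upd) with ⟦⟧*-update⁻ ps i ∈upd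
    ... | (∈pᵢ , ∉qᵢ) , restore =
      (ts , refl , restore ∈pᵢ) , λ { (_ , refl , ∈qs) → ∉qᵢ (⟦⟧*-lookup qs ∈qs i) }

  rule-sound : ∀ {xs} {p p′ : Pattern s} → Rule xs p p′ → ⟦ p ⟧ ≐ ⟦ p′ ⟧
  rule-sound (A1 _) = (λ { (inj₂ ∈v) → ∈v }) , inj₂
  rule-sound (A2 _) = (λ { (inj₁ ∈v) → ∈v }) , inj₁
  rule-sound (E1 {vs = vs} i _ vᵢ≡⊥) =
    -- Membership in `⟦ ⊥ ⟧` is the same empty type at every sort, so the transported proof about
    -- position `i` is already the goal.
    (λ { (ts , _ , ∈vs) → subst (λ p → lookup ts i ∈ ⟦ p ⟧) vᵢ≡⊥ (⟦⟧*-lookup vs ∈vs i) }) , λ ()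
  rule-sound (S1 {h = h} {vs} i {v} {w} _ vᵢ≡v+w) = to , from
    where
    ⟦v+w⟧⊆ : ⟦ v + w ⟧ ⊆ ⟦ lookup vs i ⟧
    ⟦v+w⟧⊆ {t} = subst (λ p → t ∈ ⟦ p ⟧) (sym vᵢ≡v+w)

    to : ⟦ app h vs ⟧ ⊆ ⟦ app h (vs [ i ]≔ v) + app h (vs [ i ]≔ w) ⟧
    to (ts , refl , ∈vs) =
      Sum.map (λ ∈v → ts , refl , ⟦⟧*-update⁺ vs i ∈vs ∈v)
              (λ ∈w → ts , refl , ⟦⟧*-update⁺ vs i ∈vs ∈w)
              (subst (λ p → lookup ts i ∈ ⟦ p ⟧) vᵢ≡v+w (⟦⟧*-lookup vs ∈vs i))

    from : ⟦ app h (vs [ i ]≔ v) + app h (vs [ i ]≔ w) ⟧ ⊆ ⟦ app h vs ⟧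
    from = Sum.[ app-update-⊆ h vs i (⟦v+w⟧⊆ ∘ inj₁)
               , app-update-⊆ h vs i (⟦v+w⟧⊆ ∘ inj₂) ]
  rule-sound (M1 _) = (λ { (_ , ∉V) → contradiction tt ∉V }) , λ ()
  rule-sound (M2 _) = (λ { (∈v , _) → ∈v }) , (_, λ ())
  rule-sound (M3 _ _ _) =
      (λ { (∈w , ∉v₁+v₂) → (∈w , ∉v₁+v₂ ∘ inj₁) , ∉v₁+v₂ ∘ inj₂ })
    , (λ { ((∈w , ∉v₁) , ∉v₂) → ∈w , Sum.[ ∉v₁ , ∉v₂ ] })
  -- Both minuends contain every ground term; the proof of not matching the subtrahend is carried
  -- over unchanged.
  rule-sound (M4 z _ _ _) = map₁ (λ _ → ∑ᶜ-con-universal z _) , map₁ (λ _ → tt)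
  rule-sound (M5 _) = (λ ()) , λ ()
  rule-sound (M6 _ _ _) =
      (λ { (∈v+w , ∉f) → Sum.map (_, ∉f) (_, ∉f) ∈v+w })
    , Sum.[ map₁ inj₁ , map₁ inj₂ ]
  rule-sound (M7 {f = f} {vs} {ts} _ _ _) = app∖app f vs ts
  rule-sound (M8 _ _ f≢g) =
      (λ { (∈f , _) → ∈f })
    , (λ { ∈f@(_ , refl , _) → ∈f , λ { (_ , eq , _) → f≢g (app-injectiveˡ eq) } })

  -- Stated for arbitrary `xs` because a step inside a subpattern still avoids the variables of the
  -- whole pattern; with `xs` tied to `vars p` the induction hypothesis would not apply.
  step-sound : ∀ {xs} {p p′ : Pattern s} → Step xs p p′ → ⟦ p ⟧ ≐ ⟦ p′ ⟧
  step-sound (here r) = rule-sound r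
  step-sound (arg {f = f} {ps} i st) with step-sound st
  ... | p⊆p′ , p′⊆p =
      (λ { (ts , refl , ∈ps) → ts , refl , ⟦⟧*-update⁺ ps i ∈ps (p⊆p′ (⟦⟧*-lookup ps ∈ps i)) })
    , app-update-⊆ f ps i p′⊆p
  step-sound (+ˡ st) with step-sound st
  ... | p⊆p′ , p′⊆p = Sum.map₁ p⊆p′ , Sum.map₁ p′⊆p
  step-sound (+ʳ st) with step-sound st
  ... | q⊆q′ , q′⊆q = Sum.map₂ q⊆q′ , Sum.map₂ q′⊆q
  step-sound (∖ˡ st) with step-sound st
  ... | p⊆p′ , p′⊆p = map₁ p⊆p′ , map₁ p′⊆p
  step-sound (∖ʳ st) with step-sound st
  -- Difference is antitone in its second argument, so the two inclusions trade places.
  ... | q⊆q′ , q′⊆q = map₂ (_∘ q′⊆q) , map₂ (_∘ q⊆q′)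

proposition3p2 : (𝓢 : Signature) → let open Patterns 𝓢 in
    ∀ {s : Sort} (p p′ : Pattern s) → Linear p → p ⟹ p′ → ⟦ p ⟧ ≐ ⟦ p′ ⟧
proposition3p2 𝓢 _ _ _ = Semantics.step-sound 𝓢
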